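{- Let $p$ be a positive monotonic predicate over input $A$, and let $\Sigma^{h}_{\mathbf{p}}$ be a propositional definition for the positive predicate atom $\mathbf{p}$. If $\Sigma^{h}_{\mathbf{p}}$ is a set of Horn clauses, then for any theory lemma $M_A \Rightarrow \mathbf{p}$, where $M_A$ is a set of positive atoms from $A$, we have $\Sigma^{h}_{\mathbf{p}} \models (M_A \Rightarrow \mathbf{p})$ if and only if $\Sigma^{h}_{\mathbf{p}} \vdash_{1} (M_A \Rightarrow \mathbf{p})$.
   Context: Basic conventions. A CNF formula is a finite set (conjunction) of clauses; a clause is a disjunction of literals. An assignment (total or partial) is identified with a set of non-conflicting literals. For a formula $F$ and an assignment $M$, $F|_M$ denotes $F$ reduced by $M$: satisfied clauses are removed and falsified literals are discarded from clauses (an empty clause is $\bot$, an empty formula is $\top$). $\models$ is logical implication. A clause is Horn if it contains at most one positive literal. Unit propagation. A unit clause is a clause with one literal. The unit clause rule replaces $F$ by $F|_L$, where $L$ is the set of literals occurring in unit clauses of $F$; unit propagation is the repeated application of this rule until a fixpoint. For a clause $C$, its negation $\overline{C}$ is a set of unit clauses, and $F \vdash_{1} C$ means that unit propagation on $F \wedge \overline{C}$ derives a conflict. Monotonic predicates. A predicate $p:\{0,1\}^n\to\{0,1\}$ over Boolean arguments $A=\{a_1,\dots,a_n\}$ is positive monotonic if, for every $i$ and all values of the other arguments, $p(a_1,\dots,a_{i-1},0,a_{i+1},\dots) \implies p(a_1,\dots,a_{i-1},1,a_{i+1},\dots)$. The predicate atom $\mathbf{p}$ is a Boolean variable (not in $A$)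 indicating whether $p(A)$ is true. A theory lemma for $\mathbf{p}$ is an implication $M_A \Rightarrow \mathbf{p}$ with $M_A$ a partial assignment over $A$ (read as a conjunction of literals), i.e. the clause consisting of the negations of the literals of $M_A$ together with $\mathbf{p}$. Propositional definition. A propositional definition of $\mathbf{p}$ is a CNF formula $\Sigma_{\mathbf{p}}$ over variables $V \supseteq \{\mathbf{p}\}\cup A$ such that for every truth assignment $M$ to the variables in $A$: (1) $\Sigma_{\mathbf{p}}|_{M}$ is satisfiable, and (2) $\Sigma_{\mathbf{p}} \models (M \Rightarrow \mathbf{p})$ if and only if $p(M)$ is $\top$. -}

module Defs where

open import Data.Bool using (Bool; true; false; if_then_else_)
open import Data.Fin using (Fin)
open import Data.List using (List; []; _∷_; _++_; map; filter; mapMaybe; tabulate)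
open import Data.List.Membership.Propositional using (_∈_; _∉_)
import Data.List.Membership.DecPropositional as DecMembership
open import Data.List.Relation.Unary.All using (All; all?)
open import Data.List.Relation.Unary.Any using (Any; any?)
open import Data.Maybe using (Maybe; just; nothing)
open import Data.Product using (∃-syntax; _×_)
open import Data.Sum using (_⊎_)
open import Data.Vec using (Vec; lookup; _[_]≔_)
open import Function.Bundles using (_⇔_)
open import Relation.Binary.Construct.Closure.ReflexiveTransitive using (Star)
open import Relation.Binary.Definitions using (DecidableEquality)
open import Relation.Binary.PropositionalEquality using (_≡_; refl; cong)
open import Relation.Nullary using (¬?; no; does)
open import Relation.Nullary.Decidable using (map′)

PositiveMonotonic : ∀ {n} → (Vec Bool n → Bool) → Set
PositiveMonotonic {n} p =
  ∀ (i : Fin n) (b : Vec Bool n) →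
  p (b [ i ]≔ false) ≡ true → p (b [ i ]≔ true) ≡ true

data Literal (V : Set) : Set where
  pos neg : V → Literal V

-- Lists stand for finite sets: everything below is insensitive to the order
-- and multiplicity of literals in a clause and of clauses in a formula.

Clause : Set → Set
Clause V = List (Literal V)

CNF : Set → Set
CNF V = List (Clause V)

module _ {V : Set} where

  ~_ : Literal V → Literal V
  ~ pos x = neg x
  ~ neg x = pos x

  infix 30 ~_

  litValue : V → Bool → Literal V
  litValue x v = if v then pos x else neg x

  NonConflicting : List (Literal V) → Set
  NonConflicting M = ∀ {l} → l ∈ M → ~ l ∉ M

  _⊨ˡ_ : (V → Bool) → Literal V → Set
  τ ⊨ˡ pos x = τ x ≡ true
  τ ⊨ˡ neg x = τ x ≡ false

  _⊨ᶜ_ : (V → Bool) → Clause V → Set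
  τ ⊨ᶜ C = Any (τ ⊨ˡ_) C

  _⊨ᶠ_ : (V → Bool) → CNF V → Set
  τ ⊨ᶠ F = All (τ ⊨ᶜ_) F

  Satisfiable : CNF V → Set
  Satisfiable F = ∃[ τ ] τ ⊨ᶠ F

  _⊨_ : CNF V → Clause V → Set
  F ⊨ C = ∀ τ → τ ⊨ᶠ F → τ ⊨ᶜ C

  _⇒_ : List (Literal V) → V → Clause V
  M ⇒ x = pos x ∷ map ~_ M

  -- Stated with equality rather than a count, so that a literal repeated in
  -- the list counts once.
  HornClause : Clause V → Set
  HornClause C = ∀ {x y} → pos x ∈ C → pos y ∈ C → x ≡ y

  Horn : CNF V → Set
  Horn F = All HornClause F

  negation : Clause V → CNF V
  negation C = map (λ l → ~ l ∷ []) C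

  infix 4 _⊨ˡ_ _⊨ᶜ_ _⊨ᶠ_ _⊨_
  infix 6 _⇒_

module Propositional {V : Set} (_≟_ : DecidableEquality V) where

  _≟ˡ_ : DecidableEquality (Literal V)
  pos x ≟ˡ pos y = map′ (cong pos) (λ { refl → refl }) (x ≟ y)
  pos x ≟ˡ neg y = no λ ()
  neg x ≟ˡ pos y = no λ ()
  neg x ≟ˡ neg y = map′ (cong neg) (λ { refl → refl }) (x ≟ y)

  open DecMembership _≟ˡ_ using (_∈?_)

  _∣_ : CNF V → List (Literal V) → CNF V
  F ∣ M = map (filter λ l → ¬? (~ l ∈? M))
              (filter (λ C → ¬? (any? (_∈? M) C)) F)

  infixl 7 _∣_

  -- A clause is unit when, as a set, it is a singleton.
  unitLiteral : Clause V → Maybe (Literal V)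
  unitLiteral []      = nothing
  unitLiteral (l ∷ C) = if does (all? (_≟ˡ l) C) then just l else nothing

  units : CNF V → List (Literal V)
  units = mapMaybe unitLiteral

  -- The reduct F ∣ M only makes sense for an assignment M.  If F has two
  -- complementary unit clauses, the rule does not apply and F is a conflict.
  data _⟶_ : CNF V → CNF V → Set where
    unitClauseRule : ∀ {F} → NonConflicting (units F) → F ⟶ F ∣ units F

  Conflict : CNF V → Set
  Conflict F = [] ∈ F ⊎ ∃[ l ] (l ∈ units F × ~ l ∈ units F)

  -- The rule is deterministic and conflicts persist under it, so reaching a
  -- conflict at some stage is the same as having one at the fixpoint.
  _⊢₁_ : CNF V → Clause V → Set
  F ⊢₁ C = ∃[ G ] (Star _⟶_ (F ++ negation C) G × Conflict G)

  infix 4 _⟶_ _⊢₁_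

  -- The argument variables are A = { a i }; b is a truth assignment to them.
  assignment : ∀ {n} → (Fin n → V) → Vec Bool n → List (Literal V)
  assignment a b = tabulate λ i → litValue (a i) (lookup b i)

  PropositionalDefinition :
    ∀ {n} → (Vec Bool n → Bool) → (Fin n → V) → V → CNF V → Set
  PropositionalDefinition {n} p a 𝐩 F =
    ∀ (b : Vec Bool n) →
      Satisfiable (F ∣ assignment a b) ×
      (F ⊨ assignment a b ⇒ 𝐩 ⇔ p b ≡ true)

  PositiveAtomsOf : ∀ {n} → (Fin n → V) → List (Literal V) → Set
  PositiveAtomsOf a M = All (λ l → ∃[ i ] l ≡ pos (a i)) M

{-# OPTIONS --safe #-}

-- The clauses added by negating M ⇒ 𝐩 are unit, so the question is whether unit
-- propagation refutes every unsatisfiable Horn formula.  It does: each step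
-- deletes a unit clause, and once no unit clause and no conflict is left, every
-- clause contains a negative literal, so the all-false assignment is a model;
-- models of F ∣ U extend to models of F by making the literals of U true.

module Submission where

open import Defs
open import Data.Bool using (Bool; true; false)
open import Data.Bool.Properties using (¬-not) renaming (_≟_ to _≟ᵇ_)
open import Data.Fin using (Fin)
open import Data.List using (List; []; _∷_; _++_; filter; length)
open import Data.List.Membership.Propositional using (_∈_; _∉_; find; lose)
open import Data.List.Membership.Propositional.Properties
  using (∈-filter⁺; ∈-filter⁻; ∈-map⁺; ∈-++⁺ˡ; ∈-++⁺ʳ)
open import Data.List.Properties using (filter-notAll; length-map)
open import Data.List.Relation.Unary.All as All using (All; []; _∷_; all?)
import Data.List.Relation.Unary.All.Properties as All
open import Data.List.Relation.Unary.Any as Any using (Any; here; there; any?)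
import Data.List.Membership.DecPropositional as DecMembership
open import Data.Maybe using (just; nothing)
open import Data.Nat using (ℕ; _<_)
open import Data.Nat.Induction using (Acc; acc; <-wellFounded)
open import Data.Product using (∃-syntax; _×_; _,_; proj₁)
open import Data.Sum using (_⊎_; inj₁; inj₂)
open import Data.Vec using (Vec)
open import Function using (_∘_; case_of_)
open import Function.Bundles using (_⇔_; mk⇔)
open import Function.Definitions using (Injective)
open import Relation.Binary.Construct.Closure.ReflexiveTransitive using (Star; ε; _◅_)
open import Relation.Binary.Definitions using (DecidableEquality)
open import Relation.Binary.PropositionalEquality
  using (_≡_; _≢_; refl; sym; trans; cong; subst)
open import Relation.Nullary using (¬_; ¬?; Dec; yes; no; contradiction)
open import Relation.Nullary.Decidable using (map′; _⊎-dec_)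

empty-or-inhabited : ∀ {A : Set} (xs : List A) → xs ≡ [] ⊎ ∃[ x ] x ∈ xs
empty-or-inhabited []      = inj₁ refl
empty-or-inhabited (x ∷ _) = inj₂ (x , here refl)

module _ {V : Set} where

  ⊨ˡ? : (τ : V → Bool) (l : Literal V) → Dec (τ ⊨ˡ l)
  ⊨ˡ? τ (pos x) = τ x ≟ᵇ true
  ⊨ˡ? τ (neg x) = τ x ≟ᵇ false

  ⊨ˡ-consistent : ∀ {τ : V → Bool} l → τ ⊨ˡ l → ¬ (τ ⊨ˡ ~ l)
  ⊨ˡ-consistent (pos x) t f = case trans (sym t) f of λ ()
  ⊨ˡ-consistent (neg x) f t = case trans (sym t) f of λ ()

  ⊭ˡ⇒⊨ˡ~ : ∀ {τ : V → Bool} l → ¬ (τ ⊨ˡ l) → τ ⊨ˡ ~ l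
  ⊭ˡ⇒⊨ˡ~ (pos x) = ¬-not
  ⊭ˡ⇒⊨ˡ~ (neg x) = ¬-not

  ⊨-negation⁺ : ∀ {τ : V → Bool} C → ¬ (τ ⊨ᶜ C) → τ ⊨ᶠ negation C
  ⊨-negation⁺ C ¬C =
    All.map⁺ (All.map (λ {l} ¬l → here (⊭ˡ⇒⊨ˡ~ l ¬l)) (All.¬Any⇒All¬ C ¬C))

  ⊨-negation⁻ : ∀ {τ : V → Bool} C → τ ⊨ᶠ negation C → ¬ (τ ⊨ᶜ C)
  ⊨-negation⁻ C sat C-true with find C-true
  ... | l , l∈C , l-true with All.lookup (All.map⁻ sat) l∈C
  ... | here ~l-true = ⊨ˡ-consistent l l-true ~l-true

  Horn-singleton : ∀ {l : Literal V} → HornClause (l ∷ [])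
  Horn-singleton (here refl) (here refl) = refl

  Horn-negation : (C : Clause V) → Horn (negation C)
  Horn-negation []      = []
  Horn-negation (l ∷ C) = Horn-singleton ∷ Horn-negation C

module _ {V : Set} (_≟_ : DecidableEquality V) where

  open Propositional _≟_
  open DecMembership _≟ˡ_ using (_∈?_)

  module _ (U : List (Literal V)) where

    satisfied? : (C : Clause V) → Dec (Any (_∈ U) C)
    satisfied? = any? (_∈? U)

    unfalsified? : (l : Literal V) → Dec (~ l ∉ U)
    unfalsified? l = ¬? (~ l ∈? U)

    ∈-∣⁺ : ∀ {C F} → C ∈ F → ¬ Any (_∈ U) C → filter unfalsified? C ∈ F ∣ U
    ∈-∣⁺ C∈F C-open = ∈-map⁺ _ (∈-filter⁺ (¬? ∘ satisfied?) C∈F C-open)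

    -- Every clause of the reduct is a shortened clause of the original, so a per-clause check
    -- suffices. This serves both for the Horn property and for models.
    ∣-All : ∀ {P Q : Clause V → Set} → (∀ {C} → P C → Q (filter unfalsified? C)) →
            ∀ {F} → All P F → All Q (F ∣ U)
    ∣-All P⇒Q = All.map⁺ ∘ All.map P⇒Q ∘ All.filter⁺ (¬? ∘ satisfied?)

    Horn-∣ : ∀ {F} → Horn F → Horn (F ∣ U)
    Horn-∣ = ∣-All {HornClause} {HornClause} λ horn x∈C y∈C →
      horn (proj₁ (∈-filter⁻ unfalsified? x∈C)) (proj₁ (∈-filter⁻ unfalsified? y∈C))

    -- The literal that makes a clause true survives the filter: were its complement in `U`, `τ`
    -- would make both true.
    ⊨-∣ : ∀ {τ F} → All (τ ⊨ˡ_) U → τ ⊨ᶠ F → τ ⊨ᶠ F ∣ U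
    ⊨-∣ {τ} U-true = ∣-All λ C-true → let l , l∈C , l-true = find C-true in
      lose (∈-filter⁺ unfalsified? l∈C (⊨ˡ-consistent l l-true ∘ All.lookup U-true)) l-true

    -- Shortening clauses does not change their number, so the strict drop comes from a satisfied
    -- clause being removed. This is the termination measure.
    length-∣ : ∀ F → Any (Any (_∈ U)) F → length (F ∣ U) < length F
    length-∣ F C-satisfied
      rewrite length-map (filter unfalsified?) (filter (¬? ∘ satisfied?) F) =
      filter-notAll (¬? ∘ satisfied?) F (Any.map (λ s ¬s → ¬s s) C-satisfied)

    -- `τ` updated by the assignment `U`. Positive literals are looked up first, so agreement with
    -- the negative literals of `U` depends on `NonConflicting U`.
    override : (V → Bool) → V → Bool
    override τ x with pos x ∈? U | neg x ∈? U
    ... | yes _ | _     = true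
    ... | no _  | yes _ = false
    ... | no _  | no _  = τ x

    override-∈ : ∀ {τ} → NonConflicting U → ∀ {l} → l ∈ U → override τ ⊨ˡ l
    override-∈ consistent {pos x} x∈U with pos x ∈? U | neg x ∈? U
    ... | yes _   | _ = refl
    ... | no  x∉U | _ = contradiction x∈U x∉U
    override-∈ consistent {neg x} x∈U with pos x ∈? U | neg x ∈? U
    ... | yes px∈U | _        = contradiction px∈U (consistent x∈U)
    ... | no _     | yes _    = refl
    ... | no _     | no  x∉U  = contradiction x∈U x∉U

    override-∉ : ∀ {τ l} → l ∉ U → ~ l ∉ U → τ ⊨ˡ l → override τ ⊨ˡ l
    override-∉ {l = pos x} l∉U ~l∉U l-true with pos x ∈? U | neg x ∈? U
    ... | yes l∈U | _        = contradiction l∈U l∉U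
    ... | no _    | yes ~l∈U = contradiction ~l∈U ~l∉U
    ... | no _    | no _     = l-true
    override-∉ {l = neg x} l∉U ~l∉U l-true with pos x ∈? U | neg x ∈? U
    ... | yes ~l∈U | _       = contradiction ~l∈U ~l∉U
    ... | no _     | yes l∈U = contradiction l∈U l∉U
    ... | no _     | no _    = l-true

    -- A removed clause is true through its literal in `U`. Any other clause has a true literal in
    -- its shortened form, and `U` mentions neither that literal nor its complement, so `τ` still
    -- decides it.
    override-⊨ : ∀ {τ F} → NonConflicting U → τ ⊨ᶠ F ∣ U → override τ ⊨ᶠ F
    override-⊨ {τ} consistent sat = All.tabulate clause
      where
      clause : ∀ {C} → C ∈ _ → override τ ⊨ᶜ C
      clause {C} C∈F with satisfied? C
      ... | yes C-satisfied = Any.map (override-∈ consistent) C-satisfied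
      ... | no C-open with find (All.lookup sat (∈-∣⁺ C∈F C-open))
      ... | l , l∈filter , l-true =
        let l∈C , ~l∉U = ∈-filter⁻ unfalsified? l∈filter
        in lose l∈C (override-∉ (C-open ∘ lose l∈C) ~l∉U l-true)

  unitLiteral-just : ∀ C {l} → unitLiteral C ≡ just l → l ∈ C × All (_≡ l) C
  unitLiteral-just (l ∷ C) eq with all? (_≟ˡ l) C
  unitLiteral-just (l ∷ C) refl | yes C≡l = here refl , refl ∷ C≡l
  unitLiteral-just (l ∷ C) ()   | no _

  units-nothing : ∀ F → units F ≡ [] → All (λ C → unitLiteral C ≡ nothing) F
  units-nothing []      _  = []
  units-nothing (C ∷ F) eq with unitLiteral C in eqC
  ... | nothing = eqC ∷ units-nothing F eq

  ∈-units⁻ : ∀ F {l} → l ∈ units F → Any (λ C → unitLiteral C ≡ just l) F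
  ∈-units⁻ (C ∷ F) l∈ with unitLiteral C in eqC
  ∈-units⁻ (C ∷ F) (here refl) | just _  = here eqC
  ∈-units⁻ (C ∷ F) (there l∈)  | just _  = there (∈-units⁻ F l∈)
  ∈-units⁻ (C ∷ F) l∈          | nothing = there (∈-units⁻ F l∈)

  -- All literals of a unit clause are equal, so whichever one a model makes true is the unit
  -- literal.
  ⊨-units : ∀ {τ} F → τ ⊨ᶠ F → All (τ ⊨ˡ_) (units F)
  ⊨-units {τ} F sat = All.tabulate λ l∈ →
    let C , C∈F , C-unit = find (∈-units⁻ F l∈)
        _ , C≡l = unitLiteral-just C C-unit
        k , k∈C , k-true = find (All.lookup sat C∈F)
    in subst (τ ⊨ˡ_) (All.lookup C≡l k∈C) k-true

  -- The unit clause that contributes `l` contains a literal of `units F`, hence is itself deleted.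
  length-∣-units : ∀ F {l} → l ∈ units F → length (F ∣ units F) < length F
  length-∣-units F l∈ = length-∣ (units F) F
    (Any.map (λ {C} C-unit → lose (proj₁ (unitLiteral-just C C-unit)) l∈) (∈-units⁻ F l∈))

  -- Unit literals are forced, so the same `τ` remains a model at each step.
  ⊨-⟶* : ∀ {τ F G} → Star _⟶_ F G → τ ⊨ᶠ F → τ ⊨ᶠ G
  ⊨-⟶* ε sat = sat
  ⊨-⟶* {F = F} (unitClauseRule _ ◅ steps) sat =
    ⊨-⟶* steps (⊨-∣ (units F) (⊨-units F sat) sat)

  Conflict⇒⊭ : ∀ {τ F} → Conflict F → ¬ (τ ⊨ᶠ F)
  Conflict⇒⊭ (inj₁ []∈F) sat = case All.lookup sat []∈F of λ ()
  Conflict⇒⊭ {F = F} (inj₂ (l , l∈ , ~l∈)) sat =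
    ⊨ˡ-consistent l (All.lookup true-units l∈) (All.lookup true-units ~l∈)
    where true-units = ⊨-units F sat

  -- If `τ` falsified `C`, it would satisfy `negation C` as well as `F`, and would stay a model all
  -- the way to the conflict.
  ⊢₁⇒⊨ : ∀ F C → F ⊢₁ C → F ⊨ C
  ⊢₁⇒⊨ F C (G , steps , conflict) τ sat with any? (⊨ˡ? τ) C
  ... | yes C-true = C-true
  ... | no ¬C = contradiction (⊨-⟶* steps (All.++⁺ sat (⊨-negation⁺ C ¬C)))
                              (Conflict⇒⊭ conflict)

  conflict? : ∀ F → Dec (Conflict F)
  conflict? F = any? isEmpty? F ⊎-dec
    map′ find (λ (_ , l∈ , ~l∈) → lose l∈ ~l∈) (any? (λ l → ~ l ∈? units F) (units F))
    where
    isEmpty? : (C : Clause V) → Dec ([] ≡ C)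
    isEmpty? []      = yes refl
    isEmpty? (_ ∷ _) = no λ ()

  nonunit-Horn-⊨ : ∀ C → [] ≢ C → HornClause C → unitLiteral C ≡ nothing →
                   (λ _ → false) ⊨ᶜ C
  nonunit-Horn-⊨ [] nonempty _ _ = contradiction refl nonempty
  nonunit-Horn-⊨ (neg x ∷ C) _ _ _ = here refl
  nonunit-Horn-⊨ (pos x ∷ C) _ horn nonunit with all? (_≟ˡ pos x) C
  nonunit-Horn-⊨ (pos x ∷ C) _ horn () | yes _
  -- Not being unit yields a literal of `C` other than `pos x`; the Horn condition forces it to be
  -- negative, hence true under the all-false assignment.
  ... | no C≢x with find (All.¬All⇒Any¬ (_≟ˡ pos x) C C≢x)
  ... | neg y , y∈C , _   = there (lose y∈C refl)
  ... | pos y , y∈C , y≢x =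
    contradiction (cong pos (horn (there y∈C) (here refl))) y≢x

  unit-free-Horn-⊨ : ∀ {F} → Horn F → ¬ Conflict F → units F ≡ [] → (λ _ → false) ⊨ᶠ F
  unit-free-Horn-⊨ {F} horn ¬conflict no-units = All.tabulate λ {C} C∈F →
    nonunit-Horn-⊨ C (λ { refl → ¬conflict (inj₁ C∈F) })
      (All.lookup horn C∈F) (All.lookup (units-nothing F no-units) C∈F)

  Horn-satisfiable-or-refuted :
    ∀ F → Horn F → Satisfiable F ⊎ ∃[ G ] (Star _⟶_ F G × Conflict G)
  Horn-satisfiable-or-refuted F horn = propagate F horn (<-wellFounded (length F))
    where
    propagate : ∀ F → Horn F → Acc _<_ (length F) →
                Satisfiable F ⊎ ∃[ G ] (Star _⟶_ F G × Conflict G)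
    propagate F horn (acc smaller) with conflict? F
    ... | yes conflict = inj₂ (F , ε , conflict)
    ... | no ¬conflict with empty-or-inhabited (units F)
    ... | inj₁ no-units = inj₁ (_ , unit-free-Horn-⊨ horn ¬conflict no-units)
    ... | inj₂ (l , l∈)
      with propagate (F ∣ units F) (Horn-∣ (units F) horn)
             (smaller (length-∣-units F l∈))
    -- In both outcomes `¬conflict` supplies `NonConflicting (units F)`: once to pull the model
    -- back, once to license the propagation step.
    ... | inj₁ (τ , sat) =
      inj₁ (_ , override-⊨ (units F) (λ l∈ ~l∈ → ¬conflict (inj₂ (_ , l∈ , ~l∈))) sat)
    ... | inj₂ (G , steps , conflict) =
      inj₂ (G , unitClauseRule (λ l∈ ~l∈ → ¬conflict (inj₂ (_ , l∈ , ~l∈))) ◅ steps , conflict)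

  -- Negating `C` adds only one-literal clauses, which are Horn, so the dichotomy applies to the
  -- extended formula. A model of it would satisfy `F` yet falsify `C`, leaving only refutation.
  Horn-⊨⇒⊢₁ : ∀ F C → Horn F → F ⊨ C → F ⊢₁ C
  Horn-⊨⇒⊢₁ F C horn F⊨C
    with Horn-satisfiable-or-refuted (F ++ negation C) (All.++⁺ horn (Horn-negation C))
  ... | inj₂ refuted   = refuted
  ... | inj₁ (τ , sat) =
    contradiction (F⊨C τ (All.++⁻ˡ F sat)) (⊨-negation⁻ C (All.++⁻ʳ F sat))

theorem1 : ∀ {V : Set} (_≟_ : DecidableEquality V) → let open Propositional _≟_ in
    ∀ (n : ℕ) (p : Vec Bool n → Bool) → PositiveMonotonic p →
    ∀ (a : Fin n → V) → Injective _≡_ _≡_ a →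
    ∀ (𝐩 : V) → (∀ i → a i ≢ 𝐩) →
    ∀ (F : CNF V) → PropositionalDefinition p a 𝐩 F → Horn F →
    ∀ (M : List (Literal V)) → PositiveAtomsOf a M →
    (F ⊨ M ⇒ 𝐩) ⇔ (F ⊢₁ M ⇒ 𝐩)
theorem1 _≟_ _ _ _ _ _ 𝐩 _ F _ horn M _ =
  mk⇔ (Horn-⊨⇒⊢₁ _≟_ F (M ⇒ 𝐩) horn) (⊢₁⇒⊨ _≟_ F (M ⇒ 𝐩))
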